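{- Let $\mathbf P=(P,\le,0,1)$ be a bounded poset satisfying the Ascending Chain Condition as well as the Descending Chain Condition, let $\mathbf Q=(Q,\le,0)$ be a poset with least element $0$, let $f$ be an up-homomorphism from $\mathbf P$ to $\mathbf Q$, let $f^*\colon Q\to\mathbb A(\mathbf P)$ denote the operator for which $(f,f^*)$ is a pair of operator-residuated mappings between $\mathbf P$ and $\mathbf Q$, and let $a,b\in P$. Then $f(a)=f(b)$ (i.e. $(a,b)\in\ker f$) if and only if \[ \operatorname{Min}U\Big(f^*\big(f(a)\big),f^*(0)\Big)=\operatorname{Min}U\Big(f^*\big(f(b)\big),f^*(0)\Big). \]
   Context: For a poset $(P,\le)$ and $A,B\subseteq P$: $U(A)$ is the set of all upper bounds of $A$ in $P$, $U(A,B):=U(A\cup B)$, $U(x,y):=U(\{x,y\})$, and $\operatorname{Min}A$ is the set of all minimal elements of $A$. A mapping $f\colon P\to Q$ between posets is an up-homomorphism if $f\big(\operatorname{Min}U(x,y)\big)=\operatorname{Min}U\big(f(x),f(y)\big)$ (equality of subsets of $Q$, the left side being the image of a set under $f$) for all $x,y\in P$. The Ascending (Descending) Chain Condition means that there are no infinite strictly ascending (descending) chains. A bounded poset is one with least element $0$ and greatest element $1$. $\mathbb A(\mathbf P)$ is the set of all non-empty antichains of $\mathbf P$. A pair of operator-residuated mappings between $\mathbf P$ and $\mathbf Q$ is a pair $(f,f^*)$ with $f\colon P\to Q$ and $f^*\colon Q\to\mathbb A(\mathbf P)$ such that for all $x\in P$, $y\in Q$: $f(x)\le y$ if and only if there is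 some $z\in f^*(y)$ with $x\le z$. Such an $f^*$ is uniquely determined by $f$. $\ker f=\{(x,y)\in P^2\mid f(x)=f(y)\}$. -}

module Defs where

open import Data.Product using (∃-syntax; _×_)
open import Data.Sum using (_⊎_)
open import Function using (_⇔_; flip)
open import Function.Bundles using (Func; _⟨$⟩_)
open import Induction.InfiniteDescent using (InfiniteDescendingSequence)
open import Level using (Level; suc; _⊔_)
open import Relation.Binary using (Poset; Setoid; _Respects_)
open import Relation.Binary.Construct.On using () renaming (isEquivalence to on-isEquivalence)
open import Relation.Binary.Properties.Poset using () renaming (_<_ to strict)
open import Relation.Nullary using (¬_)
open import Relation.Unary using (Pred; _∈_; _∪_; _≐_; Satisfiable)
open import Relation.Unary.Relation.Binary.Equality using (≐-isEquivalence)

-- Posets carry a setoid equality _≈_, so throughout "equal elements"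
-- means related by _≈_.  Subsets are predicates, compared by _≐_.

module _ {p₁ p₂ p₃ : Level} (P : Poset p₁ p₂ p₃) where

  open Poset P

  U : ∀ {ℓ} → Pred Carrier ℓ → Pred Carrier (p₁ ⊔ p₃ ⊔ ℓ)
  U A u = ∀ x → x ∈ A → x ≤ u

  U₂ : ∀ {ℓ₁ ℓ₂} → Pred Carrier ℓ₁ → Pred Carrier ℓ₂ →
       Pred Carrier (p₁ ⊔ p₃ ⊔ ℓ₁ ⊔ ℓ₂)
  U₂ A B = U (A ∪ B)

  pair : Carrier → Carrier → Pred Carrier p₂
  pair x y z = z ≈ x ⊎ z ≈ y

  Min : ∀ {ℓ} → Pred Carrier ℓ → Pred Carrier (p₁ ⊔ p₂ ⊔ p₃ ⊔ ℓ)
  Min A m = m ∈ A × (∀ x → x ∈ A → x ≤ m → x ≈ m)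

  -- strict P x y unfolds to x ≤ y × ¬ (x ≈ y).

  ACC : Set (p₁ ⊔ p₂ ⊔ p₃)
  ACC = ¬ (∃[ c ] InfiniteDescendingSequence (flip (strict P)) c)

  DCC : Set (p₁ ⊔ p₂ ⊔ p₃)
  DCC = ¬ (∃[ c ] InfiniteDescendingSequence (strict P) c)

  record NonEmptyAntichain (ℓ : Level) : Set (p₁ ⊔ p₂ ⊔ p₃ ⊔ suc ℓ) where
    field
      elements  : Pred Carrier ℓ
      resp      : elements Respects _≈_
      nonEmpty  : Satisfiable elements
      antichain : ∀ x y → x ∈ elements → y ∈ elements → x ≤ y → x ≈ y

  open NonEmptyAntichain public using (elements)

  𝔸 : (ℓ : Level) → Setoid (p₁ ⊔ p₂ ⊔ p₃ ⊔ suc ℓ) (p₁ ⊔ ℓ)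
  𝔸 ℓ = record
    { Carrier       = NonEmptyAntichain ℓ
    ; _≈_           = λ A B → elements A ≐ elements B
    ; isEquivalence = on-isEquivalence elements ≐-isEquivalence
    }

module _ {p₁ p₂ p₃ q₁ q₂ q₃ : Level}
         (P : Poset p₁ p₂ p₃) (Q : Poset q₁ q₂ q₃) where

  private
    module P = Poset P
    module Q = Poset Q

  image : ∀ {ℓ} → Func P.Eq.setoid Q.Eq.setoid →
          Pred P.Carrier ℓ → Pred Q.Carrier (p₁ ⊔ q₂ ⊔ ℓ)
  image f A y = ∃[ x ] (x ∈ A × y Q.≈ (f ⟨$⟩ x))

  IsUpHomomorphism : Func P.Eq.setoid Q.Eq.setoid →
                     Set (p₁ ⊔ p₂ ⊔ p₃ ⊔ q₁ ⊔ q₂ ⊔ q₃)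
  IsUpHomomorphism f = ∀ x y →
    image f (Min P (U P (pair P x y)))
      ≐ Min Q (U Q (pair Q (f ⟨$⟩ x) (f ⟨$⟩ y)))

  IsOperatorResiduated : ∀ {ℓ} → Func P.Eq.setoid Q.Eq.setoid →
                         Func Q.Eq.setoid (𝔸 P ℓ) →
                         Set (p₁ ⊔ p₃ ⊔ q₁ ⊔ q₃ ⊔ ℓ)
  IsOperatorResiduated f f* = ∀ x y →
    ((f ⟨$⟩ x) Q.≤ y) ⇔ (∃[ z ] (z ∈ elements (f* ⟨$⟩ y) × x P.≤ z))

{-# OPTIONS --safe #-}

-- Each f*(f(a)) has a greatest element z, and f(z) = f(a): if z' also lies in
-- f*(f(a)), the up-homomorphism property at z', z yields an upper bound w of
-- both with f(w) = f(a), so w lies below an element of the antichain f*(f(a)),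
-- which must be z.  As f(c) ≤ 0 ≤ f(a) for c in f*(0), z also dominates f*(0), so
-- Min U(f*(f(a)), f*(0)) = {z}, and z determines f(a).

module Submission where

open import Defs
open import Axiom.ExcludedMiddle using (ExcludedMiddle)
open import Data.Product using (∃-syntax; _×_; _,_; proj₁; proj₂)
open import Data.Sum using (inj₁; inj₂; [_,_])
open import Function using (_⇔_; mk⇔; Equivalence; _∘_)
open import Function.Bundles using (Func; _⟨$⟩_)
open import Level using (Level)
open import Relation.Binary using (Poset; Minimum; Maximum)
open import Relation.Unary using (Pred; _∈_; _⊆_; _≐_)

module _ {p₁ p₂ p₃ : Level} (P : Poset p₁ p₂ p₃) where

  open Poset P

  U-pair : ∀ {x y u} → x ≤ u → y ≤ u → u ∈ U P (pair P x y)
  U-pair x≤u y≤u v (inj₁ v≈x) = trans (reflexive v≈x) x≤u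
  U-pair x≤u y≤u v (inj₂ v≈y) = trans (reflexive v≈y) y≤u

  U-pair-fst : ∀ {x y u} → u ∈ U P (pair P x y) → x ≤ u
  U-pair-fst u∈ = u∈ _ (inj₁ Eq.refl)

  U-pair-snd : ∀ {x y u} → u ∈ U P (pair P x y) → y ≤ u
  U-pair-snd u∈ = u∈ _ (inj₂ Eq.refl)

  greatest∈Min-U : ∀ {ℓ} {A : Pred Carrier ℓ} {z} → z ∈ A → z ∈ U P A → z ∈ Min P (U P A)
  greatest∈Min-U z∈A z∈U = z∈U , λ u u∈U u≤z → antisym u≤z (u∈U _ z∈A)

  y∈Min-U-pair : ∀ {x y} → x ≤ y → y ∈ Min P (U P (pair P x y))
  y∈Min-U-pair x≤y = greatest∈Min-U (inj₂ Eq.refl) (U-pair x≤y refl)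

  Min-cong : ∀ {ℓ₁ ℓ₂} {A : Pred Carrier ℓ₁} {B : Pred Carrier ℓ₂} →
             A ≐ B → Min P A ≐ Min P B
  Min-cong (A⊆B , B⊆A) =
    (λ (m∈A , min) → A⊆B m∈A , λ x → min x ∘ B⊆A) ,
    (λ (m∈B , min) → B⊆A m∈B , λ x → min x ∘ A⊆B)

  U₂-anti : ∀ {ℓ₁ ℓ₂ ℓ₃} {A : Pred Carrier ℓ₁} {B : Pred Carrier ℓ₂} (C : Pred Carrier ℓ₃) →
             A ⊆ B → U₂ P B C ⊆ U₂ P A C
  U₂-anti C A⊆B u∈ x = [ u∈ x ∘ inj₁ ∘ A⊆B , u∈ x ∘ inj₂ ]

  Min-U₂-cong : ∀ {ℓ₁ ℓ₂ ℓ₃} {A : Pred Carrier ℓ₁} {B : Pred Carrier ℓ₂} (C : Pred Carrier ℓ₃) →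
                A ≐ B → Min P (U₂ P A C) ≐ Min P (U₂ P B C)
  Min-U₂-cong C (A⊆B , B⊆A) = Min-cong (U₂-anti C B⊆A , U₂-anti C A⊆B)

module _ {p₁ p₂ p₃ q₁ q₂ q₃ : Level}
         (P : Poset p₁ p₂ p₃) (Q : Poset q₁ q₂ q₃) where

  private
    module P = Poset P
    module Q = Poset Q

  module UpHomomorphism (f : Func P.Eq.setoid Q.Eq.setoid) (up : IsUpHomomorphism P Q f) where

    -- When `x ≤ y`, `y` is itself a minimal upper bound of the pair, so the forward inclusion of
    -- `up` makes its image an upper bound of `f ⟨$⟩ x`.
    mono : ∀ {x y} → x P.≤ y → (f ⟨$⟩ x) Q.≤ (f ⟨$⟩ y)
    mono {x} {y} x≤y =
      U-pair-fst Q (proj₁ (proj₁ (up x y) (y , y∈Min-U-pair P x≤y , Q.Eq.refl)))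

    -- The backward inclusion of `up`: `f ⟨$⟩ y` is a minimal upper bound of both values, hence the
    -- image of some minimal upper bound `w` of `x` and `y`. This `w` stands in for a join.
    upperBound : ∀ {x y} → (f ⟨$⟩ x) Q.≤ (f ⟨$⟩ y) →
                 ∃[ w ] (x P.≤ w × y P.≤ w × (f ⟨$⟩ y) Q.≈ (f ⟨$⟩ w))
    upperBound {x} {y} fx≤fy with proj₂ (up x y) (y∈Min-U-pair Q fx≤fy)
    ... | w , (w∈U , _) , fy≈fw = w , U-pair-fst P w∈U , U-pair-snd P w∈U , fy≈fw

    module Residuated {ℓ} (f* : Func Q.Eq.setoid (𝔸 P ℓ)) (res : IsOperatorResiduated P Q f f*) where

      below : ∀ {x y} → (f ⟨$⟩ x) Q.≤ y → ∃[ z ] (z ∈ elements (f* ⟨$⟩ y) × x P.≤ z)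
      below = Equivalence.to (res _ _)

      f*-sound : ∀ {y z} → z ∈ elements (f* ⟨$⟩ y) → (f ⟨$⟩ z) Q.≤ y
      f*-sound z∈ = Equivalence.from (res _ _) (_ , z∈ , P.refl)

      -- Here `x` ranges over everything that `f` sends below `f ⟨$⟩ a`, so that one statement
      -- serves for members of `f*` at `f ⟨$⟩ a` and at `0Q` alike.
      greatest : ∀ {a x z} → a P.≤ z → z ∈ elements (f* ⟨$⟩ (f ⟨$⟩ a)) →
                 (f ⟨$⟩ x) Q.≤ (f ⟨$⟩ a) → x P.≤ z
      greatest {a} {x} {z} a≤z z∈ fx≤fa =
        -- The assumption `a≤z` enters here: it gives `f ⟨$⟩ x ≤ f ⟨$⟩ a ≤ f ⟨$⟩ z`, the comparison
        -- that `upperBound` requires.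
        let w , x≤w , z≤w , fz≈fw = upperBound (Q.trans fx≤fa (mono a≤z))
            v , v∈ , w≤v = below (Q.trans (Q.reflexive (Q.Eq.sym fz≈fw)) (f*-sound z∈))
            z≈v = NonEmptyAntichain.antichain (f* ⟨$⟩ (f ⟨$⟩ a)) z v z∈ v∈ (P.trans z≤w w≤v)
        in P.trans x≤w (P.trans w≤v (P.reflexive (P.Eq.sym z≈v)))

      module _ (0Q : Q.Carrier) (0-min : Minimum Q._≤_ 0Q) where

        M : P.Carrier → Pred P.Carrier _
        M a = Min P (U₂ P (elements (f* ⟨$⟩ (f ⟨$⟩ a))) (elements (f* ⟨$⟩ 0Q)))

        M-satisfiable : ∀ a → ∃[ z ] (z ∈ M a × (f ⟨$⟩ z) Q.≤ (f ⟨$⟩ a))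
        M-satisfiable a =
          let z , z∈ , a≤z = below (Q.refl {f ⟨$⟩ a})
              z∈U x = greatest a≤z z∈ ∘ [ f*-sound , (λ x∈ → Q.trans (f*-sound x∈) (0-min _)) ]
          in z , greatest∈Min-U P (inj₁ z∈) z∈U , f*-sound z∈

        -- Some member of `f*` at `f ⟨$⟩ a` lies above `a`, and `u` bounds that member.
        f≤f-on-M : ∀ {a u} → u ∈ M a → (f ⟨$⟩ a) Q.≤ (f ⟨$⟩ u)
        f≤f-on-M (u∈U , _) =
          let z , z∈ , a≤z = below Q.refl
          in mono (P.trans a≤z (u∈U z (inj₁ z∈)))

        -- The witness `z` of `M a` is carried into `M b`, whence `f ⟨$⟩ b ≤ f ⟨$⟩ z ≤ f ⟨$⟩ a`;
        -- this is why the order is reversed.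
        M-reflects-≤ : ∀ {a b} → M a ⊆ M b → (f ⟨$⟩ b) Q.≤ (f ⟨$⟩ a)
        M-reflects-≤ {a} Ma⊆Mb =
          let z , z∈M , fz≤fa = M-satisfiable a
          in Q.trans (f≤f-on-M (Ma⊆Mb z∈M)) fz≤fa

        ker⇔M : ∀ a b → ((f ⟨$⟩ a) Q.≈ (f ⟨$⟩ b)) ⇔ (M a ≐ M b)
        ker⇔M a b = mk⇔
          (λ fa≈fb → Min-U₂-cong P (elements (f* ⟨$⟩ 0Q)) (Func.cong f* fa≈fb))
          (λ (Ma⊆Mb , Mb⊆Ma) → Q.antisym (M-reflects-≤ Mb⊆Ma) (M-reflects-≤ Ma⊆Mb))

theorem4p4 :
    (∀ {ℓ} → ExcludedMiddle ℓ) →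
    ∀ {p₁ p₂ p₃ q₁ q₂ q₃ a₁ : Level}
    (P : Poset p₁ p₂ p₃) (Q : Poset q₁ q₂ q₃) →
    let module P = Poset P
        module Q = Poset Q
    in
    (0P 1P : P.Carrier) → Minimum P._≤_ 0P → Maximum P._≤_ 1P →
    ACC P → DCC P →
    (0Q : Q.Carrier) → Minimum Q._≤_ 0Q →
    (f : Func P.Eq.setoid Q.Eq.setoid) → IsUpHomomorphism P Q f →
    (f* : Func Q.Eq.setoid (𝔸 P a₁)) → IsOperatorResiduated P Q f f* →
    (a b : P.Carrier) →
    ((f ⟨$⟩ a) Q.≈ (f ⟨$⟩ b))
      ⇔
    (Min P (U₂ P (elements (f* ⟨$⟩ (f ⟨$⟩ a))) (elements (f* ⟨$⟩ 0Q)))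
      ≐
     Min P (U₂ P (elements (f* ⟨$⟩ (f ⟨$⟩ b))) (elements (f* ⟨$⟩ 0Q))))
theorem4p4 _ P Q _ _ _ _ _ _ 0Q 0-min f up f* res =
  UpHomomorphism.Residuated.ker⇔M P Q f up f* res 0Q 0-min
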